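{- If $G$ is a connected graph of order $n$, then $\iota_{\rm g}(G)\le \frac{1}{2}n$, with equality if and only if $G\in\{K_2, C_6\}$.
   Context: For a graph $G$ and $X\subseteq V(G)$, $N_G[X]$ denotes the set of vertices in $X$ or adjacent to a vertex of $X$. The isolation game on a finite graph $G$ is played by two players, Dominator and Staller, who alternately select vertices of $G$. If $X$ is the set of vertices selected so far, a vertex $x$ may be selected (is playable) only if $x$ dominates (i.e., equals or is adjacent to) some vertex belonging to a component of $G - N_G[X]$ with at least two vertices. The game ends when no playable vertex exists. Dominator aims to minimize the total number of selected vertices, Staller aims to maximize it. The game isolation number $\iota_{\rm g}(G)$ is the number of vertices selected when Dominator makes the first move and both play optimally. $C_6$ is the cycle on six vertices. -}

module Defs where

open import Data.Nat using (ℕ; zero; suc; _≤_; _*_)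
open import Data.Fin using (Fin; zero; suc; _≟_)
open import Data.Fin.Patterns
open import Data.Bool using (Bool; true; false; T; _∨_; not)
open import Data.Bool.Properties using (∨-comm)
open import Data.List using (List; []; _∷_)
open import Data.List.Membership.Propositional using (_∈_)
open import Data.Product using (Σ; ∃; _×_; _,_; ∃-syntax)
open import Data.Sum using (_⊎_)
open import Data.Empty using (⊥)
open import Data.Unit using (⊤)
open import Relation.Nullary using (¬_; does)
open import Relation.Binary.PropositionalEquality using (_≡_; _≢_; refl; cong₂)
open import Function.Bundles using (Inverse; _⇔_)

record Graph (n : ℕ) : Set where
  field
    adj    : Fin n → Fin n → Bool
    sym    : ∀ u v → adj u v ≡ adj v u
    irrefl : ∀ u → adj u u ≡ false

open Graph public

Adj : ∀ {n} → Graph n → Fin n → Fin n → Set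
Adj G u v = T (adj G u v)

Dominates : ∀ {n} → Graph n → Fin n → Fin n → Set
Dominates G u v = u ≡ v ⊎ Adj G u v

data WalkIn {n} (G : Graph n) (P : Fin n → Set) : Fin n → Fin n → Set where
  here : ∀ {u} → P u → WalkIn G P u u
  step : ∀ {u v w} → P u → Adj G u v → WalkIn G P v w → WalkIn G P u w

Connected : ∀ {n} → Graph n → Set
Connected {n} G = (1 ≤ n) × (∀ u v → WalkIn G (λ _ → ⊤) u v)

InClosedNbhd : ∀ {n} → Graph n → List (Fin n) → Fin n → Set
InClosedNbhd G X v = ∃[ x ] (x ∈ X × Dominates G x v)

Remaining : ∀ {n} → Graph n → List (Fin n) → Fin n → Set
Remaining G X v = ¬ InClosedNbhd G X v

InNontrivialComponent : ∀ {n} → Graph n → List (Fin n) → Fin n → Set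
InNontrivialComponent G X y =
  Remaining G X y × ∃[ z ] (z ≢ y × WalkIn G (Remaining G X) y z)

Playable : ∀ {n} → Graph n → List (Fin n) → Fin n → Set
Playable G X x = ∃[ y ] (Dominates G x y × InNontrivialComponent G X y)

GameOver : ∀ {n} → Graph n → List (Fin n) → Set
GameOver G X = ∀ x → ¬ Playable G X x

-- DomVal G f X k : with Dominator to move in position X, optimal play
-- yields exactly k further selected vertices (Staller similarly).
-- f is a recursion fuel (depth bound); every selected vertex is new,
-- so fuel n suffices for a graph of order n.
DomVal StalVal : ∀ {n} → Graph n → ℕ → List (Fin n) → ℕ → Set
DomVal G zero X k = GameOver G X × k ≡ 0
DomVal G (suc f) X k =
  (GameOver G X × k ≡ 0)
  ⊎ (∃[ k' ] (k ≡ suc k' ×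
       ∃[ x ] (Playable G X x × StalVal G f (x ∷ X) k')
       × (∀ y j → Playable G X y → StalVal G f (y ∷ X) j → k' ≤ j)))
StalVal G zero X k = GameOver G X × k ≡ 0
StalVal G (suc f) X k =
  (GameOver G X × k ≡ 0)
  ⊎ (∃[ k' ] (k ≡ suc k' ×
       ∃[ x ] (Playable G X x × DomVal G f (x ∷ X) k')
       × (∀ y j → Playable G X y → DomVal G f (y ∷ X) j → j ≤ k')))

IsGameIsolationNumber : ∀ {n} → Graph n → ℕ → Set
IsGameIsolationNumber {n} G k = DomVal G n [] k

_≅_ : ∀ {n m} → Graph n → Graph m → Set
_≅_ {n} {m} G H =
  Σ (Inverse (≡-setoid′ n) (≡-setoid′ m)) λ f →
    ∀ u v → adj G u v ≡ adj H (Inverse.to f u) (Inverse.to f v)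
  where
    open import Relation.Binary.PropositionalEquality using (setoid)
    ≡-setoid′ = λ k → setoid (Fin k)

K₂ : Graph 2
K₂ = record { adj = a ; sym = s ; irrefl = i }
  where
    a : Fin 2 → Fin 2 → Bool
    a 0F 1F = true
    a 1F 0F = true
    a _ _ = false
    s : ∀ u v → a u v ≡ a v u
    s 0F 0F = refl
    s 0F 1F = refl
    s 1F 0F = refl
    s 1F 1F = refl
    i : ∀ u → a u u ≡ false
    i 0F = refl
    i 1F = refl

cyc6 : Fin 6 → Fin 6
cyc6 0F = 1F
cyc6 1F = 2F
cyc6 2F = 3F
cyc6 3F = 4F
cyc6 4F = 5F
cyc6 5F = 0F

C₆ : Graph 6
C₆ = record { adj = a ; sym = s ; irrefl = i }
  where
    a : Fin 6 → Fin 6 → Bool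
    a u v = does (cyc6 u ≟ v) ∨ does (cyc6 v ≟ u)
    s : ∀ u v → a u v ≡ a v u
    s u v = ∨-comm (does (cyc6 u ≟ v)) (does (cyc6 v ≟ u))
    i : ∀ u → a u u ≡ false
    i 0F = refl
    i 1F = refl
    i 2F = refl
    i 3F = refl
    i 4F = refl
    i 5F = refl

{-# OPTIONS --safe #-}
module Submission where

-- Call a vertex live if it lies in a nontrivial component of G − N[X].  Every move kills at
-- least one live vertex.  If some component has three or more vertices, Dominator kills three
-- by playing a vertex of degree at least two in it, so two consecutive moves kill four; if all
-- components are K₂, every move kills two.  Hence the value is at most half the number of live
-- vertices, and strictly less as soon as Dominator can kill four at once.  In the case of
-- equality with n ≥ 4 this forces maximum degree two, hence G has paths of every order up to n:
-- n = 4 still admits a move killing four, n = 6 gives C₆, and for n ≥ 8 Dominator can open so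
-- that either Staller's reply kills two or Dominator's second move kills four.

open import Defs
open import Data.Nat using (ℕ; zero; suc; _+_; _*_; _≤_; _<_; z≤n; s≤s; s≤s⁻¹)
open import Data.Nat.Properties
  using (≤-refl; ≤-reflexive; ≤-trans; ≤-antisym; <-irrefl; n≮0; n≤1+n; *-suc;
         *-monoʳ-≤; +-monoʳ-≤)
open import Data.Bool using (true; false; T)
open import Data.Bool.Properties using (T?; T-∨)
open import Data.Fin using (Fin; zero; suc; _≟_)
open import Data.Fin.Patterns
open import Data.Fin.Permutation using (↔⇒≡)
open import Data.Fin.Properties using (all?; any?; injective⇒≤)
open import Data.List using (List; []; _∷_; _++_; length; lookup; filter; allFin)
open import Data.List.Extrema.Nat
  using (argmin; argmax; argmin-all; argmax-all; f[argmin]≤f[xs]; f[xs]≤f[argmax])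
open import Data.List.Membership.DecPropositional using (_∈?_)
open import Data.List.Membership.Propositional using (_∈_; _∉_; find; lose)
open import Data.List.Membership.Propositional.Properties
  using (∈-filter⁺; ∈-filter⁻; ∈-allFin; ∈-lookup; ∈-++⁻)
open import Data.List.Properties using (length-filter; length-tabulate; length-++; length-++-comm)
open import Data.List.Relation.Unary.All as All using (All; []; _∷_)
open import Data.List.Relation.Unary.All.Properties using (all-filter; ¬Any⇒All¬)
open import Data.List.Relation.Unary.AllPairs using ([]; _∷_)
open import Data.List.Relation.Unary.Any as Any using (here; there; index)
open import Data.List.Relation.Unary.Any.Properties using (lookup-index)
open import Data.List.Relation.Unary.Linked using (Linked; [-]; _∷_)
open import Data.List.Relation.Unary.Unique.Propositional using (Unique)
open import Data.List.Relation.Unary.Unique.Propositional.Properties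
  using (++⁺; filter⁺; allFin⁺)
open import Data.Product using (_×_; _,_; proj₁; proj₂; ∃-syntax)
open import Data.Sum using (_⊎_; inj₁; inj₂; [_,_]′)
open import Data.Empty using (⊥; ⊥-elim)
open import Data.Unit using (⊤; tt)
open import Function using (_∘_)
open import Function.Bundles using (_⇔_; mk⇔; mk↔ₛ′; Equivalence; Inverse)
open import Relation.Nullary using (¬_; Dec; yes; no; does)
open import Relation.Nullary.Decidable
  using (map′; ¬?; _×-dec_; _⊎-dec_; decidable-stable; toWitness)
open import Relation.Binary.PropositionalEquality
  using (_≡_; _≢_; refl; cong; cong₂; trans; subst; subst₂; module ≡-Reasoning)
  renaming (sym to ≡-sym)

-- Duplicate-free lists, pigeonhole counting and Boolean reflection.

private
  variable
    a : Set

lookup-injective : ∀ {xs : List a} → Unique xs → ∀ i j → lookup xs i ≡ lookup xs j → i ≡ j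
lookup-injective (_ ∷ _) zero zero _ = refl
lookup-injective {xs = _ ∷ xs} (x∉ ∷ _) zero (suc j) eq =
  ⊥-elim (All.lookup x∉ (∈-lookup {xs = xs} j) eq)
lookup-injective {xs = _ ∷ xs} (x∉ ∷ _) (suc i) zero eq =
  ⊥-elim (All.lookup x∉ (∈-lookup {xs = xs} i) (≡-sym eq))
lookup-injective (_ ∷ uxs) (suc i) (suc j) eq = cong suc (lookup-injective uxs i j eq)

lookup-distinct : ∀ {xs : List a} → Unique xs → ∀ i j → i ≢ j → lookup xs i ≢ lookup xs j
lookup-distinct uxs i j i≢j eq = i≢j (lookup-injective uxs i j eq)

-- Sending each index of `xs` to the position of its entry in `ys` is injective: equal positions
-- mean equal entries, and `xs` has no repetitions.
unique-length-≤ : ∀ {xs ys : List a} → Unique xs → (∀ {v} → v ∈ xs → v ∈ ys) →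
                  length xs ≤ length ys
unique-length-≤ {xs = xs} {ys} uxs xs⊆ys = injective⇒≤ {f = position} position-injective
  where
  position : Fin (length xs) → Fin (length ys)
  position i = index (xs⊆ys (∈-lookup i))
  position-injective : ∀ {i j} → position i ≡ position j → i ≡ j
  position-injective {i} {j} eq = lookup-injective uxs i j (begin
    lookup xs i            ≡⟨ lookup-index (xs⊆ys (∈-lookup i)) ⟩
    lookup ys (position i) ≡⟨ cong (lookup ys) eq ⟩
    lookup ys (position j) ≡⟨ lookup-index (xs⊆ys (∈-lookup j)) ⟨
    lookup xs j            ∎)
    where open ≡-Reasoning

unique-full : ∀ {n} {xs : List (Fin n)} → Unique xs → length xs ≡ n → ∀ v → v ∈ xs
unique-full {n} {xs} uxs len v = decidable-stable (_∈?_ _≟_ v xs) λ v∉xs →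
  <-irrefl len (≤-trans
    (unique-length-≤ {ys = allFin n} (¬Any⇒All¬ xs v∉xs ∷ uxs) (λ _ → ∈-allFin _))
    (≤-reflexive (length-tabulate (λ i → i))))

outside : ∀ {n} (xs : List (Fin n)) → length xs < n → ∃[ v ] v ∉ xs
outside {n} xs short with any? (λ v → ¬? (_∈?_ _≟_ v xs))
... | yes found = found
... | no none = ⊥-elim (<-irrefl refl (≤-trans short (≤-trans
  (≤-reflexive (≡-sym (length-tabulate (λ i → i))))
  (unique-length-≤ (allFin⁺ n)
    (λ {v} _ → decidable-stable (_∈?_ _≟_ v xs) (λ v∉ → none (v , v∉)))))))

T-≡ : ∀ {x y} → (T x → T y) → (T y → T x) → x ≡ y
T-≡ {false} {false} _ _ = refl
T-≡ {false} {true} _ g = ⊥-elim (g tt)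
T-≡ {true} {false} f _ = ⊥-elim (f tt)
T-≡ {true} {true} _ _ = refl

does⁺ : (d : Dec a) → a → T (does d)
does⁺ (yes _) _ = tt
does⁺ (no ¬p) p = ¬p p

does⁻ : (d : Dec a) → T (does d) → a
does⁻ (yes p) _ = p

-- Domination, live vertices and playable moves.

module _ {n} (G : Graph n) where

  private
    Rem : List (Fin n) → Fin n → Set
    Rem = Remaining G

    _~_ : Fin n → Fin n → Set
    _~_ = Adj G

  ~-sym : ∀ {u v} → u ~ v → v ~ u
  ~-sym {u} {v} = subst T (sym G u v)

  ~-irrefl : ∀ {u v} → u ~ v → u ≢ v
  ~-irrefl {u} uv refl = subst T (irrefl G u) uv

  dominates-sym : ∀ {u v} → Dominates G u v → Dominates G v u
  dominates-sym (inj₁ eq) = inj₁ (≡-sym eq)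
  dominates-sym (inj₂ uv) = inj₂ (~-sym uv)

  remaining? : ∀ X v → Dec (Rem X v)
  remaining? X v = ¬? (map′ find (λ { (_ , x∈X , dom) → lose x∈X dom })
    (Any.any? (λ x → (x ≟ v) ⊎-dec T? (adj G x v)) X))

  remaining-[] : ∀ {v} → Rem [] v
  remaining-[] (_ , () , _)

  remaining-∷ : ∀ {x X v} → ¬ Dominates G x v → Rem X v → Rem (x ∷ X) v
  remaining-∷ ¬dom rem (_ , here refl , dom) = ¬dom dom
  remaining-∷ ¬dom rem (y , there y∈X , dom) = rem (y , y∈X , dom)

  remaining-tail : ∀ {x X v} → Rem (x ∷ X) v → Rem X v
  remaining-tail rem (y , y∈X , dom) = rem (y , there y∈X , dom)

  remaining-head : ∀ {x X v} → Rem (x ∷ X) v → ¬ Dominates G x v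
  remaining-head rem dom = rem (_ , here refl , dom)

  -- The first step of a walk to another vertex already gives a remaining neighbour, so this
  -- walk-free, decidable condition is equivalent to `InNontrivialComponent`.
  Live : List (Fin n) → Fin n → Set
  Live X y = Rem X y × ∃[ z ] (y ~ z × Rem X z)

  live? : ∀ X y → Dec (Live X y)
  live? X y = remaining? X y ×-dec any? (λ z → T? (adj G y z) ×-dec remaining? X z)

  live-tail : ∀ {x X v} → Live (x ∷ X) v → Live X v
  live-tail (rv , z , vz , rz) = remaining-tail rv , z , vz , remaining-tail rz

  dominated-dead : ∀ {x X v} → Dominates G x v → ¬ Live (x ∷ X) v
  dominated-dead dom (rv , _) = remaining-head rv dom

  live⇒nontrivial : ∀ {X y} → Live X y → InNontrivialComponent G X y
  live⇒nontrivial (ry , z , yz , rz) =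
    ry , z , (λ z≡y → ~-irrefl yz (≡-sym z≡y)) , step ry yz (here rz)

  nontrivial⇒live : ∀ {X y} → InNontrivialComponent G X y → Live X y
  nontrivial⇒live (ry , z , z≢y , here _) = ⊥-elim (z≢y refl)
  nontrivial⇒live (ry , z , z≢y , step _ yv (here rv)) = ry , _ , yv , rv
  nontrivial⇒live (ry , z , z≢y , step _ yv (step rv _ _)) = ry , _ , yv , rv

  playable⁺ : ∀ {X x y} → Dominates G x y → Live X y → Playable G X x
  playable⁺ dom live = _ , dom , live⇒nontrivial live

  playable⁻ : ∀ {X x} → Playable G X x → ∃[ y ] (Dominates G x y × Live X y)
  playable⁻ (y , dom , nontriv) = y , dom , nontrivial⇒live nontriv

  playable? : ∀ X x → Dec (Playable G X x)
  playable? X x = map′ (λ { (_ , dom , live) → playable⁺ dom live }) playable⁻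
    (any? λ y → ((x ≟ y) ⊎-dec T? (adj G x y)) ×-dec live? X y)

  -- Counting live vertices.

  size : List (Fin n) → ℕ
  size X = length (filter (live? X) (allFin n))

  size≤n : ∀ X → size X ≤ n
  size≤n X = ≤-trans (length-filter (live? X) (allFin n))
                     (≤-reflexive (length-tabulate (λ i → i)))

  -- A dead vertex never becomes live again, so `L` followed by the vertices still live is a
  -- duplicate-free list of vertices live in `X`.
  size-drop : ∀ {x X L} → Unique L → All (λ v → Live X v × ¬ Live (x ∷ X) v) L →
              length L + size (x ∷ X) ≤ size X
  size-drop {x} {X} {L} uL killed = ≤-trans
    (≤-reflexive (≡-sym (length-++ L)))
    (unique-length-≤
      (++⁺ uL (filter⁺ (live? (x ∷ X)) (allFin⁺ n)) λ { (v∈L , v∈after) →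
        proj₂ (All.lookup killed v∈L) (proj₂ (∈-filter⁻ (live? (x ∷ X)) {xs = allFin n} v∈after)) })
      (λ v∈ → ∈-filter⁺ (live? X) (∈-allFin _)
        ([ (λ v∈L → proj₁ (All.lookup killed v∈L))
         , (λ v∈after → live-tail (proj₂ (∈-filter⁻ (live? (x ∷ X)) {xs = allFin n} v∈after)))
         ]′ (∈-++⁻ L v∈))))

  playable-drop : ∀ {X x} → Playable G X x → size (x ∷ X) < size X
  playable-drop p with playable⁻ p
  ... | y , dom , live = size-drop ([] ∷ []) ((live , dominated-dead dom) ∷ [])

  over-0 : ∀ {X k b} → GameOver G X × k ≡ 0 → 2 * k ≤ b
  over-0 (_ , refl) = z≤n

  -- Uniqueness and existence of game values.

  domVal-unique : ∀ f {X k l} → DomVal G f X k → DomVal G f X l → k ≡ l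
  domVal-unique zero (_ , refl) (_ , refl) = refl
  domVal-unique (suc f) (inj₁ (_ , refl)) (inj₁ (_ , refl)) = refl
  domVal-unique (suc f) (inj₁ (over , _)) (inj₂ (_ , _ , x , (p , _) , _)) = ⊥-elim (over x p)
  domVal-unique (suc f) (inj₂ (_ , _ , x , (p , _) , _)) (inj₁ (over , _)) = ⊥-elim (over x p)
  domVal-unique (suc f) (inj₂ (_ , refl , x , (p , v) , min)) (inj₂ (_ , refl , y , (q , w) , min′)) =
    cong suc (≤-antisym (min y _ q w) (min′ x _ p v))

  stalVal-unique : ∀ f {X k l} → StalVal G f X k → StalVal G f X l → k ≡ l
  stalVal-unique zero (_ , refl) (_ , refl) = refl
  stalVal-unique (suc f) (inj₁ (_ , refl)) (inj₁ (_ , refl)) = refl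
  stalVal-unique (suc f) (inj₁ (over , _)) (inj₂ (_ , _ , x , (p , _) , _)) = ⊥-elim (over x p)
  stalVal-unique (suc f) (inj₂ (_ , _ , x , (p , _) , _)) (inj₁ (over , _)) = ⊥-elim (over x p)
  stalVal-unique (suc f) (inj₂ (_ , refl , x , (p , v) , max)) (inj₂ (_ , refl , y , (q , w) , max′)) =
    cong suc (≤-antisym (max′ x _ p v) (max y _ q w))

  moves : List (Fin n) → List (Fin n)
  moves X = filter (playable? X) (allFin n)

  domValue stalValue : ℕ → List (Fin n) → ℕ
  domValue zero X = 0
  domValue (suc f) X with any? (playable? X)
  ... | no _ = 0
  ... | yes (x , _) =
    -- `argmin` needs a default element; the playable `x` just found serves, so the chosen move is
    -- playable in every case.
    suc (stalValue f (argmin (λ y → stalValue f (y ∷ X)) x (moves X) ∷ X))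
  stalValue zero X = 0
  stalValue (suc f) X with any? (playable? X)
  ... | no _ = 0
  ... | yes (x , _) =
    suc (domValue f (argmax (λ y → domValue f (y ∷ X)) x (moves X) ∷ X))

  size-0-over : ∀ {X} → size X ≤ 0 → GameOver G X
  size-0-over sz x p = n≮0 (≤-trans (playable-drop p) sz)

  size-fuel : ∀ {X x f} → Playable G X x → size X ≤ suc f → size (x ∷ X) ≤ f
  size-fuel p sz = s≤s⁻¹ (≤-trans (playable-drop p) sz)

  -- A move uses one unit of fuel and kills at least one live vertex, so the hypothesis persists; at
  -- fuel zero nothing is live and the game is over.
  domValue-correct : ∀ f X → size X ≤ f → DomVal G f X (domValue f X)
  stalValue-correct : ∀ f X → size X ≤ f → StalVal G f X (stalValue f X)
  domValue-correct zero X sz = size-0-over sz , refl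
  domValue-correct (suc f) X sz with any? (playable? X)
  ... | no none = inj₁ ((λ x p → none (x , p)) , refl)
  ... | yes (x , p) = inj₂ (_ , refl , best , (best-playable , correct best-playable) , minimal)
    where
    value : Fin n → ℕ
    value y = stalValue f (y ∷ X)
    correct : ∀ {y} → Playable G X y → StalVal G f (y ∷ X) (value y)
    correct q = stalValue-correct f _ (size-fuel q sz)
    best : Fin n
    best = argmin value x (moves X)
    best-playable : Playable G X best
    best-playable = argmin-all value p (all-filter (playable? X) (allFin n))
    minimal : ∀ y j → Playable G X y → StalVal G f (y ∷ X) j → value best ≤ j
    minimal y j q v = subst (value best ≤_) (stalVal-unique f (correct q) v)
      (All.lookup (f[argmin]≤f[xs] x (moves X)) (∈-filter⁺ (playable? X) (∈-allFin y) q))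
  stalValue-correct zero X sz = size-0-over sz , refl
  stalValue-correct (suc f) X sz with any? (playable? X)
  ... | no none = inj₁ ((λ x p → none (x , p)) , refl)
  ... | yes (x , p) = inj₂ (_ , refl , best , (best-playable , correct best-playable) , maximal)
    where
    value : Fin n → ℕ
    value y = domValue f (y ∷ X)
    correct : ∀ {y} → Playable G X y → DomVal G f (y ∷ X) (value y)
    correct q = domValue-correct f _ (size-fuel q sz)
    best : Fin n
    best = argmax value x (moves X)
    best-playable : Playable G X best
    best-playable = argmax-all value p (all-filter (playable? X) (allFin n))
    maximal : ∀ y j → Playable G X y → DomVal G f (y ∷ X) j → j ≤ value best
    maximal y j q v = subst (_≤ value best) (domVal-unique f (correct q) v)
      (All.lookup (f[xs]≤f[argmax] x (moves X)) (∈-filter⁺ (playable? X) (∈-allFin y) q))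

  -- The half bound.

  -- Dominator does no worse than by playing `y`. The minimality clause needs an actual value of the
  -- position after `y`, which `stalValue` supplies; the 2 pays for the move itself.
  domVal-≤ : ∀ {f X k y b} → size X ≤ suc f → Playable G X y →
             (∀ {j} → StalVal G f (y ∷ X) j → 2 * j ≤ b) →
             DomVal G (suc f) X k → 2 * k ≤ 2 + b
  domVal-≤ sz p bound (inj₁ (over , _)) = ⊥-elim (over _ p)
  domVal-≤ {f} {X} {y = y} {b} sz p bound (inj₂ (k′ , refl , _ , _ , min)) =
    subst (_≤ 2 + b) (≡-sym (*-suc 2 k′)) (+-monoʳ-≤ 2
      (≤-trans (*-monoʳ-≤ 2 (min y _ p correct)) (bound correct)))
    where
    correct : StalVal G f (y ∷ X) (stalValue f (y ∷ X))
    correct = stalValue-correct f (y ∷ X) (size-fuel p sz)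

  stalVal-≤ : ∀ {f X j b} →
              (∀ {x k} → Playable G X x → DomVal G f (x ∷ X) k → 2 + 2 * k ≤ b) →
              StalVal G (suc f) X j → 2 * j ≤ b
  stalVal-≤ bound (inj₁ over) = over-0 over
  stalVal-≤ {b = b} bound (inj₂ (j′ , refl , x , (p , v) , _)) =
    subst (_≤ b) (≡-sym (*-suc 2 j′)) (bound p v)

  Matching : List (Fin n) → Set
  Matching X = ∀ {r p q} → Rem X r → Rem X p → Rem X q → r ~ p → r ~ q → p ≡ q

  matching-∷ : ∀ {x X} → Matching X → Matching (x ∷ X)
  matching-∷ m rr rp rq = m (remaining-tail rr) (remaining-tail rp) (remaining-tail rq)

  -- The live vertex `u` that makes `x` playable gets dominated, and its partner `z` had no
  -- remaining neighbour other than `u`, so both die.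
  matching-drop : ∀ {x X} → Matching X → Playable G X x → 2 + size (x ∷ X) ≤ size X
  matching-drop {x} {X} m p with playable⁻ p
  ... | u , dom , ru , z , uz , rz = size-drop
    ((~-irrefl uz ∷ []) ∷ [] ∷ [])
    (((ru , z , uz , rz) , dominated-dead dom) ∷ ((rz , u , ~-sym uz , ru) , z-dead) ∷ [])
    where
    z-dead : ¬ Live (x ∷ X) z
    z-dead (_ , w , zw , rw) =
      remaining-head (subst (Rem (x ∷ X)) (m rz (remaining-tail rw) ru zw (~-sym uz)) rw) dom

  matching-dom : ∀ f {X k} → Matching X → DomVal G f X k → 2 * k ≤ size X
  matching-stal : ∀ f {X k} → Matching X → StalVal G f X k → 2 * k ≤ size X
  matching-dom zero m over = over-0 over
  matching-dom (suc f) m (inj₁ over) = over-0 over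
  matching-dom (suc f) {X} m (inj₂ (k′ , refl , x , (p , v) , _)) =
    subst (_≤ size X) (≡-sym (*-suc 2 k′))
      (≤-trans (+-monoʳ-≤ 2 (matching-stal f (matching-∷ m) v)) (matching-drop m p))
  matching-stal zero m over = over-0 over
  matching-stal (suc f) m = stalVal-≤ λ p v →
    ≤-trans (+-monoʳ-≤ 2 (matching-dom f (matching-∷ m) v)) (matching-drop m p)

  -- The failure of `Matching` in positive form, so that deciding it splits cases constructively and
  -- hands Dominator the centre `r`.
  Fork : List (Fin n) → Set
  Fork X = ∃[ r ] ∃[ p ] ∃[ q ] (Rem X r × Rem X p × Rem X q × r ~ p × r ~ q × p ≢ q)

  fork? : ∀ X → Dec (Fork X)
  fork? X = any? λ r → any? λ p → any? λ q →
    remaining? X r ×-dec remaining? X p ×-dec remaining? X q ×-dec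
    T? (adj G r p) ×-dec T? (adj G r q) ×-dec ¬? (p ≟ q)

  -- Joint induction on fuel. Staller's bound has a slack of one because a reply may kill a single
  -- vertex. Dominator's move at a fork kills three: two pay for the move, one for that slack.
  domVal-half : ∀ f {X k} → size X ≤ f → DomVal G f X k → 2 * k ≤ size X
  stalVal-half : ∀ f {X k} → size X ≤ f → StalVal G f X k → 2 * k ≤ suc (size X)
  domVal-half zero sz over = over-0 over
  domVal-half (suc f) {X} sz v with fork? X
  ... | no none = matching-dom (suc f)
    (λ {r} {p} {q} rr rp rq rp~ rq~ → decidable-stable (p ≟ q)
      (λ p≢q → none (r , p , q , rr , rp , rq , rp~ , rq~ , p≢q))) v
  ... | yes (r , p , q , rr , rp , rq , r~p , r~q , p≢q) = ≤-trans
    (domVal-≤ sz playable (stalVal-half f (size-fuel playable sz)) v)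
    (size-drop
      ((~-irrefl r~p ∷ ~-irrefl r~q ∷ []) ∷ (p≢q ∷ []) ∷ [] ∷ [])
      ((r-live , dominated-dead (inj₁ refl))
       ∷ ((rp , r , ~-sym r~p , rr) , dominated-dead (inj₂ r~p))
       ∷ ((rq , r , ~-sym r~q , rr) , dominated-dead (inj₂ r~q)) ∷ []))
    where
    r-live : Live X r
    r-live = rr , p , r~p , rp
    playable : Playable G X r
    playable = playable⁺ (inj₁ refl) r-live
  stalVal-half zero sz over = over-0 over
  stalVal-half (suc f) sz = stalVal-≤ λ p v →
    s≤s (≤-trans (s≤s (domVal-half f (size-fuel p sz) v)) (playable-drop p))

  -- Moves that kill four vertices.

  BigMove : List (Fin n) → Set
  BigMove X = ∃[ r ] (Playable G X r × 4 + size (r ∷ X) ≤ size X)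

  -- Three of the four killed vertices pay for the move and for the slack in `stalVal-half`; the
  -- fourth makes the bound strict.
  bigMove-dom : ∀ f {X k} → size X ≤ f → BigMove X → DomVal G f X k → 2 * k < size X
  bigMove-dom zero sz (r , p , _) (over , _) = ⊥-elim (over r p)
  bigMove-dom (suc f) sz (r , p , drop) v =
    ≤-trans (s≤s (domVal-≤ sz p (stalVal-half f (size-fuel p sz)) v)) drop

  bigMove-star : ∀ {X r p q s} → Rem X r → Rem X p → Rem X q → Rem X s →
                 r ~ p → r ~ q → r ~ s → p ≢ q → p ≢ s → q ≢ s → BigMove X
  bigMove-star {r = r} {p} rr rp rq rs r~p r~q r~s p≢q p≢s q≢s =
    r , playable⁺ (inj₁ refl) (rr , p , r~p , rp) , size-drop
      ((~-irrefl r~p ∷ ~-irrefl r~q ∷ ~-irrefl r~s ∷ [])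
       ∷ (p≢q ∷ p≢s ∷ []) ∷ (q≢s ∷ []) ∷ [] ∷ [])
      (((rr , p , r~p , rp) , dominated-dead (inj₁ refl))
       ∷ ((rp , r , ~-sym r~p , rr) , dominated-dead (inj₂ r~p))
       ∷ ((rq , r , ~-sym r~q , rr) , dominated-dead (inj₂ r~q))
       ∷ ((rs , r , ~-sym r~s , rr) , dominated-dead (inj₂ r~s)) ∷ [])

  -- Playing r dominates q, r, s and isolates p.
  bigMove-path : ∀ {X p q r s} → Rem X p → Rem X q → Rem X r → Rem X s →
                 p ~ q → q ~ r → r ~ s → p ≢ r → p ≢ s → q ≢ s →
                 (∀ {w} → p ~ w → Rem X w → Dominates G r w) → BigMove X
  bigMove-path {p = p} {q} {r} rp rq rr rs p~q q~r r~s p≢r p≢s q≢s nbrs =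
    r , playable⁺ (inj₁ refl) (rr , q , ~-sym q~r , rq) , size-drop
      ((~-irrefl p~q ∷ p≢r ∷ p≢s ∷ []) ∷ (~-irrefl q~r ∷ q≢s ∷ [])
       ∷ (~-irrefl r~s ∷ []) ∷ [] ∷ [])
      (((rp , q , p~q , rq) , (λ { (_ , w , p~w , rw) →
          remaining-head rw (nbrs p~w (remaining-tail rw)) }))
       ∷ ((rq , r , q~r , rr) , dominated-dead (inj₂ (~-sym q~r)))
       ∷ ((rr , q , ~-sym q~r , rq) , dominated-dead (inj₁ refl))
       ∷ ((rs , r , ~-sym r~s , rr) , dominated-dead (inj₂ r~s)) ∷ [])

  -- Paths in connected graphs of maximum degree two.

  -- A walk from `a` to a vertex outside `L` has a first edge that leaves `L`.
  escape : Connected G → ∀ {a L} → a ∈ L → length L < n →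
           ∃[ u ] ∃[ v ] (u ∈ L × v ∉ L × u ~ v)
  escape (_ , walk) {a} {L} a∈L short with outside L short
  ... | w , w∉L = go (walk a w) a∈L w∉L
    where
    go : ∀ {a w} → WalkIn G (λ _ → ⊤) a w → a ∈ L → w ∉ L →
         ∃[ u ] ∃[ v ] (u ∈ L × v ∉ L × u ~ v)
    go (here _) a∈L w∉L = ⊥-elim (w∉L a∈L)
    go {a} (step {v = v} _ a~v rest) a∈L w∉L with _∈?_ _≟_ v L
    ... | yes v∈L = go rest v∈L w∉L
    ... | no v∉L = a , v , a∈L , v∉L , a~v

  -- Degree strictly below three, hence at most two.
  Subcubic : Set
  Subcubic = ∀ {m a b c} → m ~ a → m ~ b → m ~ c → a ≢ b → a ≢ c → b ≢ c → ⊥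

  IsPath : List (Fin n) → Set
  IsPath L = Linked _~_ L × Unique L

  -- `u` is not the head, and an inner vertex would have its predecessor, its successor and `v` as
  -- three neighbours. So `u` is the last vertex.
  append-linked : Subcubic → ∀ {x xs u v} → Linked _~_ (x ∷ xs) → Unique (x ∷ xs) →
                  u ∈ xs → v ∉ x ∷ xs → u ~ v → Linked _~_ (x ∷ xs ++ v ∷ [])
  append-linked deg (x~y ∷ [-]) _ (here refl) v∉ u~v = x~y ∷ u~v ∷ [-]
  append-linked deg (x~y ∷ y~z ∷ _) ((_ ∷ x≢z ∷ _) ∷ _) (here refl) v∉ u~v =
    ⊥-elim (deg (~-sym x~y) y~z u~v x≢z
      (λ x≡v → v∉ (here (≡-sym x≡v))) (λ z≡v → v∉ (there (there (here (≡-sym z≡v))))))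
  append-linked deg (x~y ∷ lk) (_ ∷ un) (there u∈) v∉ u~v =
    x~y ∷ append-linked deg lk un u∈ (v∉ ∘ there) u~v

  path-extend : Connected G → Subcubic → ∀ {x xs} → IsPath (x ∷ xs) → suc (length xs) < n →
                ∃[ L ] (length L ≡ 2 + length xs × IsPath L)
  path-extend conn deg {x} {xs} (lk , un) short with escape conn (here refl) short
  ... | u , v , here refl , v∉ , u~v =
    v ∷ x ∷ xs , refl , (~-sym u~v ∷ lk) , ¬Any⇒All¬ _ v∉ ∷ un
  ... | u , v , there u∈ , v∉ , u~v =
    x ∷ xs ++ v ∷ [] , length-++-comm (x ∷ xs) (v ∷ []) , append-linked deg lk un u∈ v∉ u~v ,
    ++⁺ un ([] ∷ []) (λ { (v∈ , here refl) → v∉ v∈ })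

  path-exists : Connected G → Subcubic → ∀ m → suc m ≤ n →
                ∃[ L ] (length L ≡ suc m × IsPath L)
  path-exists conn deg zero 1≤n with outside {n} [] 1≤n
  ... | v , _ = v ∷ [] , refl , [-] , [] ∷ []
  path-exists conn deg (suc m) m<n with path-exists conn deg m (≤-trans (n≤1+n _) m<n)
  ... | x ∷ xs , refl , path = path-extend conn deg path m<n

  subcubic-nbrs : Subcubic → ∀ {m a b w} → m ~ a → m ~ b → a ≢ b → m ~ w → w ≡ a ⊎ w ≡ b
  subcubic-nbrs deg {a = a} {b} {w} m~a m~b a≢b m~w with w ≟ a | w ≟ b
  ... | yes eq | _ = inj₁ eq
  ... | no _ | yes eq = inj₂ eq
  ... | no w≢a | no w≢b = ⊥-elim (deg m~a m~b m~w a≢b (w≢a ∘ ≡-sym) (w≢b ∘ ≡-sym))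

  subcubic-¬dominates : Subcubic → ∀ {m a b w} → m ~ a → m ~ b → a ≢ b →
                        w ≢ m → w ≢ a → w ≢ b → ¬ Dominates G m w
  subcubic-¬dominates deg m~a m~b a≢b w≢m w≢a w≢b (inj₁ m≡w) = w≢m (≡-sym m≡w)
  subcubic-¬dominates deg m~a m~b a≢b w≢m w≢a w≢b (inj₂ m~w) =
    [ w≢a , w≢b ]′ (subcubic-nbrs deg m~a m~b a≢b m~w)

  -- Orders four and six, and paths on eight vertices.

  -- The path is read backwards: `b₂` dominates `b₁`, `b₂` and `b₃`, so `b₄` keeps no remaining
  -- neighbour.
  spanning-path-4 : ∀ {b₁ b₂ b₃ b₄} → IsPath (b₁ ∷ b₂ ∷ b₃ ∷ b₄ ∷ []) → 4 ≡ n → BigMove []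
  spanning-path-4 {b₁} {b₂} {b₃} {b₄} ((e₁₂ ∷ e₂₃ ∷ e₃₄ ∷ [-]) , un) 4≡n =
    bigMove-path remaining-[] remaining-[] remaining-[] remaining-[]
      (~-sym e₃₄) (~-sym e₂₃) (~-sym e₁₂) (ne 3F 1F λ ()) (ne 3F 0F λ ()) (ne 2F 0F λ ())
      (λ {w} e _ → nbrs e (unique-full un 4≡n w))
    where
    ne = lookup-distinct un
    nbrs : ∀ {w} → b₄ ~ w → w ∈ b₁ ∷ b₂ ∷ b₃ ∷ b₄ ∷ [] → Dominates G b₂ w
    nbrs e (here refl) = inj₂ (~-sym e₁₂)
    nbrs e (there (here refl)) = inj₁ refl
    nbrs e (there (there (here refl))) = inj₂ e₂₃
    nbrs e (there (there (there (here refl)))) = ⊥-elim (~-irrefl e refl)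

  -- The labelling `b` embeds a spanning 6-cycle, and the degree bound leaves no room for chords.
  hexagon : Subcubic → (b : Fin 6 → Fin n) → (∀ i j → b i ≡ b j → i ≡ j) →
            (index-of : Fin n → Fin 6) → (∀ v → b (index-of v) ≡ v) →
            (∀ i → b i ~ b (cyc6 i)) → G ≅ C₆
  hexagon deg b inj index-of sec edge =
    mk↔ₛ′ index-of b (λ i → inj _ _ (sec (b i))) sec ,
    λ u v → subst₂ (λ x y → adj G x y ≡ adj C₆ (index-of u) (index-of v)) (sec u) (sec v)
      (T-≡ (adjacent⇒ (index-of u) (index-of v)) (adjacent⇐ (index-of u) (index-of v)))
    where
    -- `cyc6` has order six, so its fifth iterate is its inverse.
    pre : Fin 6 → Fin 6
    pre i = cyc6 (cyc6 (cyc6 (cyc6 (cyc6 i))))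
    cyc-pre : ∀ i → cyc6 (pre i) ≡ i
    cyc-pre = toWitness {a? = all? λ i → cyc6 (pre i) ≟ i} tt
    cyc≢pre : ∀ i → cyc6 i ≢ pre i
    cyc≢pre = toWitness {a? = all? λ i → ¬? (cyc6 i ≟ pre i)} tt
    back : ∀ i → b i ~ b (pre i)
    back i = ~-sym (subst (λ j → b (pre i) ~ b j) (cyc-pre i) (edge (pre i)))
    adjacent⇒ : ∀ i j → b i ~ b j → Adj C₆ i j
    adjacent⇒ i j e with subcubic-nbrs deg (edge i) (back i) (cyc≢pre i ∘ inj _ _) e
    ... | inj₁ eq = Equivalence.from T-∨ (inj₁ (does⁺ (cyc6 i ≟ j) (≡-sym (inj _ _ eq))))
    ... | inj₂ eq = Equivalence.from T-∨
      (inj₂ (does⁺ (cyc6 j ≟ i) (trans (cong cyc6 (inj _ _ eq)) (cyc-pre i))))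
    adjacent⇐ : ∀ i j → Adj C₆ i j → b i ~ b j
    adjacent⇐ i j e with Equivalence.to (T-∨ {does (cyc6 i ≟ j)}) e
    ... | inj₁ t = subst (λ k → b i ~ b k) (does⁻ (cyc6 i ≟ j) t) (edge i)
    ... | inj₂ t = ~-sym (subst (λ k → b j ~ b k) (does⁻ (cyc6 j ≟ i) t) (edge j))

  -- If the ends are adjacent, the path closes to a hexagon. Otherwise every neighbour of `b₁` is
  -- among `b₂`, `b₃`, `b₄`, and playing `b₃` kills `b₁` to `b₄`.
  spanning-path-6 : Subcubic → ∀ {b₁ b₂ b₃ b₄ b₅ b₆} →
                    IsPath (b₁ ∷ b₂ ∷ b₃ ∷ b₄ ∷ b₅ ∷ b₆ ∷ []) → 6 ≡ n → BigMove [] ⊎ G ≅ C₆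
  spanning-path-6 deg {b₁} {b₂} {b₃} {b₄} {b₅} {b₆}
    ((e₁₂ ∷ e₂₃ ∷ e₃₄ ∷ e₄₅ ∷ e₅₆ ∷ [-]) , un) 6≡n with T? (adj G b₁ b₆)
  ... | no b₁≁b₆ = inj₁ (bigMove-path remaining-[] remaining-[] remaining-[] remaining-[]
      e₁₂ e₂₃ e₃₄ (ne 0F 2F λ ()) (ne 0F 3F λ ()) (ne 1F 3F λ ())
      (λ {w} e _ → nbrs e (unique-full un 6≡n w)))
    where
    ne = lookup-distinct un
    nbrs : ∀ {w} → b₁ ~ w → w ∈ b₁ ∷ b₂ ∷ b₃ ∷ b₄ ∷ b₅ ∷ b₆ ∷ [] → Dominates G b₃ w
    nbrs e (here refl) = ⊥-elim (~-irrefl e refl)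
    nbrs e (there (here refl)) = inj₂ (~-sym e₂₃)
    nbrs e (there (there (here refl))) = inj₁ refl
    nbrs e (there (there (there (here refl)))) = inj₂ e₃₄
    -- `b₅` already has the neighbours `b₄` and `b₆`.
    nbrs e (there (there (there (there (here refl))))) = ⊥-elim
      ([ ne 0F 3F (λ ()) , ne 0F 5F (λ ()) ]′
        (subcubic-nbrs deg (~-sym e₄₅) e₅₆ (ne 3F 5F λ ()) (~-sym e)))
    nbrs e (there (there (there (there (there (here refl)))))) = ⊥-elim (b₁≁b₆ e)
  ... | yes e₁₆ = inj₂ (hexagon deg (lookup L) (lookup-injective un)
      (λ v → index (covers v)) (λ v → ≡-sym (lookup-index (covers v))) edge)
    where
    L = b₁ ∷ b₂ ∷ b₃ ∷ b₄ ∷ b₅ ∷ b₆ ∷ []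
    covers = unique-full un 6≡n
    edge : ∀ i → lookup L i ~ lookup L (cyc6 i)
    edge 0F = e₁₂
    edge 1F = e₂₃
    edge 2F = e₃₄
    edge 3F = e₄₅
    edge 4F = e₅₆
    edge 5F = ~-sym e₁₆

  -- Dominator opens with b₂.  Only the replies b₁ and b₃ can cost Staller a single vertex,
  -- and each leaves the end of a live path, on which Dominator's next move kills four vertices.
  long-path : Subcubic → ∀ {b₁ b₂ b₃ b₄ b₅ b₆ b₇ b₈} →
              IsPath (b₁ ∷ b₂ ∷ b₃ ∷ b₄ ∷ b₅ ∷ b₆ ∷ b₇ ∷ b₈ ∷ []) →
              ∀ f {k} → size [] ≤ f → DomVal G f [] k → 2 * k < size []
  long-path deg {b₁} {b₂} {b₃} {b₄} {b₅} {b₆} {b₇} {b₈}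
    ((e₁₂ ∷ e₂₃ ∷ e₃₄ ∷ e₄₅ ∷ e₅₆ ∷ e₆₇ ∷ e₇₈ ∷ [-]) , un) = dom
    where
    ne = lookup-distinct un

    live-b₂ : Live [] b₂
    live-b₂ = remaining-[] , b₃ , e₂₃ , remaining-[]

    playable-b₂ : Playable G [] b₂
    playable-b₂ = playable⁺ (inj₁ refl) live-b₂

    drop-b₂ : 3 + size (b₂ ∷ []) ≤ size []
    drop-b₂ = size-drop
      ((ne 0F 1F (λ ()) ∷ ne 0F 2F (λ ()) ∷ []) ∷ (ne 1F 2F (λ ()) ∷ []) ∷ [] ∷ [])
      (((remaining-[] , b₂ , e₁₂ , remaining-[]) , dominated-dead (inj₂ (~-sym e₁₂)))
       ∷ (live-b₂ , dominated-dead (inj₁ refl))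
       ∷ ((remaining-[] , b₄ , e₃₄ , remaining-[]) , dominated-dead (inj₂ e₂₃)) ∷ [])

    ¬dom-b₂ : ∀ {w} → w ≢ b₂ → w ≢ b₁ → w ≢ b₃ → ¬ Dominates G b₂ w
    ¬dom-b₂ = subcubic-¬dominates deg (~-sym e₁₂) e₂₃ (ne 0F 2F λ ())

    ¬dom-b₃ : ∀ {w} → w ≢ b₃ → w ≢ b₂ → w ≢ b₄ → ¬ Dominates G b₃ w
    ¬dom-b₃ = subcubic-¬dominates deg (~-sym e₂₃) e₃₄ (ne 1F 3F λ ())

    -- Dominator plays `b₆`. Each of `b₄` to `b₇` has two known neighbours other than `b₁`, so `b₁`
    -- does not dominate it. The path stops at `b₇` because `b₈` may be adjacent to `b₁`.
    big-b₁ : BigMove (b₁ ∷ b₂ ∷ [])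
    big-b₁ = bigMove-path
      (rem 3F e₃₄ e₄₅ (ne 2F 4F λ ()) (ne 0F 3F λ ()) (ne 0F 2F λ ()) (ne 0F 4F λ ())
        (ne 3F 1F λ ()) (ne 3F 2F λ ()))
      (rem 4F e₄₅ e₅₆ (ne 3F 5F λ ()) (ne 0F 4F λ ()) (ne 0F 3F λ ()) (ne 0F 5F λ ())
        (ne 4F 1F λ ()) (ne 4F 2F λ ()))
      (rem 5F e₅₆ e₆₇ (ne 4F 6F λ ()) (ne 0F 5F λ ()) (ne 0F 4F λ ()) (ne 0F 6F λ ())
        (ne 5F 1F λ ()) (ne 5F 2F λ ()))
      (rem 6F e₆₇ e₇₈ (ne 5F 7F λ ()) (ne 0F 6F λ ()) (ne 0F 5F λ ()) (ne 0F 7F λ ())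
        (ne 6F 1F λ ()) (ne 6F 2F λ ()))
      e₄₅ e₅₆ e₆₇ (ne 3F 5F λ ()) (ne 3F 6F λ ()) (ne 4F 6F λ ()) nbrs
      where
      L = b₁ ∷ b₂ ∷ b₃ ∷ b₄ ∷ b₅ ∷ b₆ ∷ b₇ ∷ b₈ ∷ []
      rem : ∀ i {p q} → p ~ lookup L i → lookup L i ~ q → p ≢ q → b₁ ≢ lookup L i →
            b₁ ≢ p → b₁ ≢ q → lookup L i ≢ b₂ → lookup L i ≢ b₃ →
            Rem (b₁ ∷ b₂ ∷ []) (lookup L i)
      rem i p~ ~q p≢q b₁≢ b₁≢p b₁≢q ≢b₂ ≢b₃ = remaining-∷
        (subcubic-¬dominates deg (~-sym p~) ~q p≢q b₁≢ b₁≢p b₁≢q ∘ dominates-sym)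
        (remaining-∷ (¬dom-b₂ ≢b₂ (b₁≢ ∘ ≡-sym) ≢b₃) remaining-[])
      nbrs : ∀ {w} → b₄ ~ w → Rem (b₁ ∷ b₂ ∷ []) w → Dominates G b₆ w
      nbrs e rw with subcubic-nbrs deg (~-sym e₃₄) e₄₅ (ne 2F 4F λ ()) e
      ... | inj₁ refl = ⊥-elim (remaining-head (remaining-tail rw) (inj₂ e₂₃))
      ... | inj₂ refl = inj₂ (~-sym e₅₆)

    -- Both neighbours of `b₂` and of `b₃` are known, so `b₅` to `b₈` all remain. Dominator plays
    -- `b₇`; the other neighbour `b₄` of `b₅` is already dominated by `b₃`.
    big-b₃ : BigMove (b₃ ∷ b₂ ∷ [])
    big-b₃ = bigMove-path
      (rem (ne 4F 0F λ ()) (ne 4F 1F λ ()) (ne 4F 2F λ ()) (ne 4F 3F λ ()))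
      (rem (ne 5F 0F λ ()) (ne 5F 1F λ ()) (ne 5F 2F λ ()) (ne 5F 3F λ ()))
      (rem (ne 6F 0F λ ()) (ne 6F 1F λ ()) (ne 6F 2F λ ()) (ne 6F 3F λ ()))
      (rem (ne 7F 0F λ ()) (ne 7F 1F λ ()) (ne 7F 2F λ ()) (ne 7F 3F λ ()))
      e₅₆ e₆₇ e₇₈ (ne 4F 6F λ ()) (ne 4F 7F λ ()) (ne 5F 7F λ ()) nbrs
      where
      rem : ∀ {w} → w ≢ b₁ → w ≢ b₂ → w ≢ b₃ → w ≢ b₄ → Rem (b₃ ∷ b₂ ∷ []) w
      rem ≢b₁ ≢b₂ ≢b₃ ≢b₄ = remaining-∷ (¬dom-b₃ ≢b₃ ≢b₂ ≢b₄)
        (remaining-∷ (¬dom-b₂ ≢b₂ ≢b₁ ≢b₃) remaining-[])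
      nbrs : ∀ {w} → b₅ ~ w → Rem (b₃ ∷ b₂ ∷ []) w → Dominates G b₇ w
      nbrs e rw with subcubic-nbrs deg (~-sym e₄₅) e₅₆ (ne 3F 5F λ ()) e
      ... | inj₁ refl = ⊥-elim (remaining-head rw (inj₂ e₃₄))
      ... | inj₂ refl = inj₂ (~-sym e₆₇)

    -- An undominated `x` dies together with a remaining neighbour. A dominated `x` is one of `b₁`,
    -- `b₂`, `b₃`, and `b₂` has no remaining neighbour.
    reply : ∀ {x} → Playable G (b₂ ∷ []) x →
            2 + size (x ∷ b₂ ∷ []) ≤ size (b₂ ∷ []) ⊎ BigMove (x ∷ b₂ ∷ [])
    reply {x} p with playable⁻ p
    ... | u , inj₁ refl , ru , z , u~z , rz = inj₁ (size-drop ((~-irrefl u~z ∷ []) ∷ [] ∷ [])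
      (((ru , z , u~z , rz) , dominated-dead (inj₁ refl))
       ∷ ((rz , u , ~-sym u~z , ru) , dominated-dead (inj₂ u~z)) ∷ []))
    ... | u , inj₂ x~u , ru , live with x ≟ b₂ | x ≟ b₁ | x ≟ b₃
    ... | yes refl | _ | _ = ⊥-elim (remaining-head ru (inj₂ x~u))
    ... | no _ | yes refl | _ = inj₂ big-b₁
    ... | no _ | no _ | yes refl = inj₂ big-b₃
    ... | no ≢b₂ | no ≢b₁ | no ≢b₃ = inj₁ (size-drop ((~-irrefl x~u ∷ []) ∷ [] ∷ [])
      (((rx , u , x~u , ru) , dominated-dead (inj₁ refl))
       ∷ ((ru , live) , dominated-dead (inj₂ x~u)) ∷ []))
      where
      rx : Rem (b₂ ∷ []) x
      rx = remaining-∷ (¬dom-b₂ ≢b₂ ≢b₁ ≢b₃) remaining-[]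

    -- Here the slack of `stalVal-half` is gone, so the three vertices killed by the opening leave
    -- one to spare.
    stal : ∀ f {j} → size (b₂ ∷ []) ≤ f → StalVal G f (b₂ ∷ []) j → 2 * j ≤ size (b₂ ∷ [])
    stal zero sz over = over-0 over
    stal (suc f) sz = stalVal-≤ λ {x} p v →
      [ ≤-trans (+-monoʳ-≤ 2 (domVal-half f (size-fuel p sz) v))
      , (λ big → ≤-trans (s≤s (bigMove-dom f (size-fuel p sz) big v)) (playable-drop p))
      ]′ (reply p)

    dom : ∀ f {k} → size [] ≤ f → DomVal G f [] k → 2 * k < size []
    dom zero sz (over , _) = ⊥-elim (over b₂ playable-b₂)
    dom (suc f) sz v =
      ≤-trans (s≤s (domVal-≤ sz playable-b₂ (stal f (size-fuel playable-b₂ sz)) v)) drop-b₂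

  -- Lower bounds for the extremal graphs.

  domVal-positive : ∀ f {X x k} → Playable G X x → DomVal G f X k → 1 ≤ k
  domVal-positive zero p (over , _) = ⊥-elim (over _ p)
  domVal-positive (suc f) p (inj₁ (over , _)) = ⊥-elim (over _ p)
  domVal-positive (suc f) p (inj₂ (_ , refl , _)) = s≤s z≤n

  stalVal-≥2 : ∀ f {X y z j} → size X ≤ f → Playable G X y → Playable G (y ∷ X) z →
               StalVal G f X j → 2 ≤ j
  stalVal-≥2 zero sz p q (over , _) = ⊥-elim (over _ p)
  stalVal-≥2 (suc f) sz p q (inj₁ (over , _)) = ⊥-elim (over _ p)
  stalVal-≥2 (suc f) {X} {y} sz p q (inj₂ (_ , refl , _ , _ , max)) =
    s≤s (≤-trans (domVal-positive f q v) (max y _ p v))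
    where
    v : DomVal G f (y ∷ X) (domValue f (y ∷ X))
    v = domValue-correct f (y ∷ X) (size-fuel p sz)

  -- `x₀` shows the game is not yet over; after any opening `x`, Staller can choose `y`, and `z`
  -- shows that a third move follows.
  domVal-≥3 : ∀ f {X x₀ k} → size X ≤ f → Playable G X x₀ →
              (∀ x → ∃[ y ] ∃[ z ] (Playable G (x ∷ X) y × Playable G (y ∷ x ∷ X) z)) →
              DomVal G f X k → 3 ≤ k
  domVal-≥3 zero sz p reply (over , _) = ⊥-elim (over _ p)
  domVal-≥3 (suc f) sz p reply (inj₁ (over , _)) = ⊥-elim (over _ p)
  domVal-≥3 (suc f) sz p reply (inj₂ (_ , refl , x , (q , v) , _)) with reply x
  ... | _ , _ , r , s = s≤s (stalVal-≥2 f (size-fuel q sz) r s v)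

  connected-playable : Connected G → 2 ≤ n → ∃[ x ] Playable G [] x
  connected-playable conn 2≤n with outside {n} [] (≤-trans (n≤1+n _) 2≤n)
  ... | a , _ with escape conn {a} {a ∷ []} (here refl) 2≤n
  ... | u , v , _ , _ , u~v = u , playable⁺ (inj₁ refl) (remaining-[] , v , u~v , remaining-[])

  -- Staller answers x by a neighbour of x; the two antipodes then form an undominated edge.
  hexagon-value : G ≅ C₆ → ∀ {k} → IsGameIsolationNumber G k → 3 ≤ k
  hexagon-value (iso , adj≡) = domVal-≥3 n (size≤n []) playable-0 reply
    where
    open Inverse iso using (to; from; strictlyInverseˡ; strictlyInverseʳ)
    adjacent : ∀ {i j} → Adj C₆ i j → from i ~ from j
    adjacent {i} {j} = subst T (≡-sym (trans (adj≡ (from i) (from j))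
      (cong₂ (adj C₆) (strictlyInverseˡ i) (strictlyInverseˡ j))))
    ¬dominates : ∀ {i j} → ¬ Dominates C₆ i j → ¬ Dominates G (from i) (from j)
    ¬dominates {i} {j} ¬dom (inj₁ eq) = ¬dom (inj₁
      (trans (≡-sym (strictlyInverseˡ i)) (trans (cong to eq) (strictlyInverseˡ j))))
    ¬dominates {i} {j} ¬dom (inj₂ e) = ¬dom (inj₂ (subst T (trans (adj≡ (from i) (from j))
      (cong₂ (adj C₆) (strictlyInverseˡ i) (strictlyInverseˡ j))) e))
    dominates? : ∀ i j → Dec (Dominates C₆ i j)
    dominates? i j = (i ≟ j) ⊎-dec T? (adj C₆ i j)
    next : ∀ i → Adj C₆ i (cyc6 i)
    next = toWitness {a? = all? λ i → T? (adj C₆ i (cyc6 i))} tt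
    far₂ : ∀ i → ¬ Dominates C₆ i (cyc6 (cyc6 i))
    far₂ = toWitness {a? = all? λ i → ¬? (dominates? i (cyc6 (cyc6 i)))} tt
    far₃ : ∀ i → ¬ Dominates C₆ i (cyc6 (cyc6 (cyc6 i)))
    far₃ = toWitness {a? = all? λ i → ¬? (dominates? i (cyc6 (cyc6 (cyc6 i))))} tt
    far₄ : ∀ i → ¬ Dominates C₆ i (cyc6 (cyc6 (cyc6 (cyc6 i))))
    far₄ = toWitness {a? = all? λ i → ¬? (dominates? i (cyc6 (cyc6 (cyc6 (cyc6 i)))))} tt
    playable-0 : Playable G [] (from 0F)
    playable-0 = playable⁺ (inj₁ refl)
      (remaining-[] , from 1F , adjacent (next 0F) , remaining-[])
    reply-from : ∀ i → ∃[ y ] ∃[ z ] (Playable G (from i ∷ []) y × Playable G (y ∷ from i ∷ []) z)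
    reply-from i = from i₁ , from i₃ ,
      -- `i₁` is already dominated by `i`; it is playable through its neighbour `i₂`, which is live
      -- thanks to `i₃`.
      playable⁺ (inj₂ (adjacent (next i₁)))
        (remaining-∷ (¬dominates (far₂ i)) remaining-[] , from i₃ , adjacent (next i₂) ,
         remaining-∷ (¬dominates (far₃ i)) remaining-[]) ,
      playable⁺ (inj₁ refl)
        (remaining-∷ (¬dominates (far₂ i₁)) (remaining-∷ (¬dominates (far₃ i)) remaining-[]) ,
         from (cyc6 i₃) , adjacent (next i₃) ,
         remaining-∷ (¬dominates (far₃ i₁)) (remaining-∷ (¬dominates (far₄ i)) remaining-[]))
      where
      i₁ = cyc6 i
      i₂ = cyc6 i₁
      i₃ = cyc6 i₂
    reply : ∀ x → ∃[ y ] ∃[ z ] (Playable G (x ∷ []) y × Playable G (y ∷ x ∷ []) z)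
    reply x = subst (λ v → ∃[ y ] ∃[ z ] (Playable G (v ∷ []) y × Playable G (y ∷ v ∷ []) z))
      (strictlyInverseʳ x) (reply-from (to x))

  -- The inequality and its equality case.

  value-half : ∀ {k} → IsGameIsolationNumber G k → 2 * k ≤ n
  value-half v = ≤-trans (domVal-half n (size≤n []) v) (size≤n [])

  tight-¬bigMove : ∀ {k} → IsGameIsolationNumber G k → 2 * k ≡ n → ¬ BigMove []
  tight-¬bigMove v eq big =
    <-irrefl eq (≤-trans (bigMove-dom n (size≤n []) big v) (size≤n []))

  -- Tightness forbids big moves, in particular stars with three leaves. The order is twice the
  -- value, so `m` separates the orders 4, 6 and at least 8.
  tight-classification : Connected G → ∀ m → IsGameIsolationNumber G (2 + m) →
                         2 * (2 + m) ≡ n → G ≅ C₆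
  tight-classification conn m v eq = by-order m v eq
    where
    deg : Subcubic
    deg m~a m~b m~c a≢b a≢c b≢c = tight-¬bigMove v eq
      (bigMove-star remaining-[] remaining-[] remaining-[] remaining-[] m~a m~b m~c a≢b a≢c b≢c)
    by-order : ∀ m → IsGameIsolationNumber G (2 + m) → 2 * (2 + m) ≡ n → G ≅ C₆
    by-order 0 v eq with path-exists conn deg 3 (≤-reflexive eq)
    ... | _ ∷ _ ∷ _ ∷ _ ∷ [] , refl , path =
      ⊥-elim (tight-¬bigMove v eq (spanning-path-4 path eq))
    by-order 1 v eq with path-exists conn deg 5 (≤-reflexive eq)
    ... | _ ∷ _ ∷ _ ∷ _ ∷ _ ∷ _ ∷ [] , refl , path =
      [ ⊥-elim ∘ tight-¬bigMove v eq , (λ iso → iso) ]′ (spanning-path-6 deg path eq)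
    by-order (suc (suc m)) v eq
      with path-exists conn deg 7
        -- The value is at least 4, so there are at least 8 vertices.
        (≤-trans (*-monoʳ-≤ 2 {4} (s≤s (s≤s (s≤s (s≤s z≤n))))) (≤-reflexive eq))
    ... | _ ∷ _ ∷ _ ∷ _ ∷ _ ∷ _ ∷ _ ∷ _ ∷ [] , refl , path =
      ⊥-elim (<-irrefl eq (≤-trans (long-path deg path n (size≤n []) v) (size≤n [])))

connected-2 : (G : Graph 2) → Connected G → G ≅ K₂
connected-2 G (_ , walk) = mk↔ₛ′ (λ i → i) (λ i → i) (λ _ → refl) (λ _ → refl) , adj≡
  where
  first-step : WalkIn G (λ _ → ⊤) 0F 1F → adj G 0F 1F ≡ true
  -- A first step that stays at `0F` would be a loop, so the walk must use the edge to `1F`.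
  first-step (step {v = 0F} _ e _) = ⊥-elim (~-irrefl G e refl)
  first-step (step {v = 1F} _ e _) = T-≡ (λ _ → tt) (λ _ → e)
  adj≡ : ∀ u v → adj G u v ≡ adj K₂ u v
  adj≡ 0F 0F = irrefl G 0F
  adj≡ 0F 1F = first-step (walk 0F 1F)
  adj≡ 1F 0F = trans (sym G 1F 0F) (first-step (walk 0F 1F))
  adj≡ 1F 1F = irrefl G 1F

tight⇒extremal : ∀ {n} (G : Graph n) → Connected G → ∀ k → IsGameIsolationNumber G k →
                 2 * k ≡ n → G ≅ K₂ ⊎ G ≅ C₆
-- Value zero would force order zero, which `Connected` excludes.
tight⇒extremal G (() , _) 0 v refl
tight⇒extremal G conn 1 v refl = inj₁ (connected-2 G conn)
tight⇒extremal G conn (suc (suc m)) v eq = inj₂ (tight-classification G conn m v eq)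

-- An isomorphism fixes the order at 2 or 6; the half bound then meets the lower bounds of one and
-- three moves.
extremal⇒tight : ∀ {n} (G : Graph n) → Connected G → ∀ k → IsGameIsolationNumber G k →
                 G ≅ K₂ ⊎ G ≅ C₆ → 2 * k ≡ n
extremal⇒tight G conn k v (inj₁ (iso , _)) with ↔⇒≡ iso
... | refl = ≤-antisym (value-half G v)
  (*-monoʳ-≤ 2 (domVal-positive G 2 (proj₂ (connected-playable G conn ≤-refl)) v))
extremal⇒tight G conn k v (inj₂ iso) with ↔⇒≡ (proj₁ iso)
... | refl = ≤-antisym (value-half G v) (*-monoʳ-≤ 2 (hexagon-value G iso v))

theorem3p1 : ∀ {n} (G : Graph n) → Connected G →
    (∃[ k ] IsGameIsolationNumber G k)
    × (∀ k → IsGameIsolationNumber G k →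
    (2 * k ≤ n) × ((2 * k ≡ n) ⇔ (G ≅ K₂ ⊎ G ≅ C₆)))
theorem3p1 {n} G conn =
  -- At most `n` vertices are live at the start, so fuel `n` suffices.
  (_ , domValue-correct G n [] (size≤n G [])) ,
  λ k v → value-half G v , mk⇔ (tight⇒extremal G conn k v) (extremal⇒tight G conn k v)
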